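{- Let $X\in\{K,D,T,B,S4,S5\}$. For every $\phi\in\mathcal{L}^{\cap\cup}$: if $\phi$ is valid in the class $\mathcal{C}_X$, then $\vdash_{\Lambda_X}\phi$.
   Context: Fix a countably infinite set $P$ of propositional variables and an at most countable set $\mathbb{I}$ of primitive types. An index is a finite nonempty subset of $\mathbb{I}$. The language $\mathcal{L}^{\cap\cup}$ is given by $\phi ::= p \mid \neg\phi \mid (\phi\to\phi) \mid \Box_i\phi \mid [\cap_I]\phi \mid [\cup^+_I]\phi$ with $p\in P$, $i\in\mathbb{I}$, $I$ an index. A Kripke model is $M=(S,R,V)$ with $S\neq\emptyset$, $R$ assigning to each $i\in\mathbb{I}$ a binary relation $R_i$ on $S$, $V:P\to\wp(S)$. Truth: $M,s\models p$ iff $s\in V(p)$; Boolean clauses as usual; $M,s\models\Box_i\phi$ iff $M,t\models\phi$ for all $t$ with $(s,t)\in R_i$; $M,s\models[\cap_I]\phi$ iff $M,t\models\phi$ for all $t$ with $(s,t)\in\bigcap_{i\in I}R_i$; $M,s\models[\cup^+_I]\phi$ iff $M,t\models\phi$ for all $t$ with $(s,t)$ in the transitive closure of $\bigcup_{i\in I}R_i$. $\mathcal{C}_K$ is the class of all Kripke models; $\mathcal{C}_D$ (resp. $\mathcal{C}_T,\mathcal{C}_B,\mathcal{C}_{S4},\mathcal{C}_{S5}$) the class of models in which every $R_i$ is serial (resp. reflexive; reflexive and symmetric; reflexive and transitive; an equivalence relation). A formula is valid in a class if it is true at every state of every model in the class. Axiomatizations (schemes over $\mathcal{L}^{\cap\cup}$,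 for all $i\in\mathbb{I}$, indices $I,J$): $\Lambda_K$ consists of all propositional tautologies, modus ponens, (K) $\Box_i(\phi\to\psi)\to(\Box_i\phi\to\Box_i\psi)$, (N) from $\phi$ infer $\Box_i\phi$, (K$\cap$) $[\cap_I](\phi\to\psi)\to([\cap_I]\phi\to[\cap_I]\psi)$, (N$\cap$) from $\phi$ infer $[\cap_I]\phi$, ($\cap$1) $\Box_i\phi\leftrightarrow[\cap_{\{i\}}]\phi$, ($\cap$2) $[\cap_I]\phi\to[\cap_J]\phi$ if $I\subseteq J$, (K$\cup$) $[\cup^+_I](\phi\to\psi)\to([\cup^+_I]\phi\to[\cup^+_I]\psi)$, ($\cup$1) $[\cup^+_I]\phi\to\Box_i(\phi\wedge[\cup^+_I]\phi)$ if $i\in I$, ($\cup$2) from $\phi\to\bigwedge_{i\in I}\Box_i(\phi\wedge\psi)$ infer $\phi\to[\cup^+_I]\psi$. Further $\Lambda_D=\Lambda_K+$(D) $\Box_i\phi\to\neg\Box_i\neg\phi$; $\Lambda_T=\Lambda_K+$(T) $\Box_i\phi\to\phi$ $+$(T$\cap$) $[\cap_I]\phi\to\phi$; $\Lambda_B=\Lambda_T+$(B) $\neg\phi\to\Box_i\neg\Box_i\phi$ $+$(B$\cap$) $\neg\phi\to[\cap_I]\neg[\cap_I]\phi$; $\Lambda_{S4}=\Lambda_T+$(4) $\Box_i\phi\to\Box_i\Box_i\phi$ $+$(4$\cap$) $[\cap_I]\phi\to[\cap_I][\cap_I]\phi$; $\Lambda_{S5}=\Lambda_T+$(5) $\neg\Box_i\phi\to\Box_i\neg\Box_i\phi$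 $+$(5$\cap$) $\neg[\cap_I]\phi\to[\cap_I]\neg[\cap_I]\phi$. -}

module Defs where

open import Level using (0ℓ)
open import Data.Nat using (ℕ)
open import Data.Bool using (Bool; true; false; not; _∧_; _∨_)
open import Data.List using (List; []; _∷_)
open import Data.List.NonEmpty using (List⁺; _∷_; toList)
open import Data.List.Membership.Propositional using (_∈_)
open import Data.Product using (Σ; ∃; _×_; _,_)
open import Data.Empty using (⊥)
open import Data.Unit using (⊤)
open import Relation.Nullary using (¬_)
open import Relation.Binary.PropositionalEquality using (_≡_)
open import Relation.Binary.Core using (Rel)
open import Relation.Binary.Definitions using (Reflexive; Symmetric; Transitive)
open import Relation.Binary.Structures using (IsEquivalence)
open import Relation.Binary.Construct.Closure.Transitive using (TransClosure)
open import Function.Definitions using (Injective)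

AtMostCountable : Set → Set
AtMostCountable A = Σ (A → ℕ) (Injective _≡_ _≡_)

data Sys : Set where
  K D T B S4 S5 : Sys

ExtendsT : Sys → Set
ExtendsT T  = ⊤
ExtendsT B  = ⊤
ExtendsT S4 = ⊤
ExtendsT S5 = ⊤
ExtendsT _  = ⊥


module Lang (𝕀 : Set) where

  -- an index: a finite nonempty subset of 𝕀, given by a nonempty list
  -- (only membership matters everywhere below)
  Index : Set
  Index = List⁺ 𝕀

  _∈ᴵ_ : 𝕀 → Index → Set
  i ∈ᴵ I = i ∈ toList I

  _⊆ᴵ_ : Index → Index → Set
  I ⊆ᴵ J = ∀ i → i ∈ᴵ I → i ∈ᴵ J

  data Form : Set where
    var  : ℕ → Form
    ~_   : Form → Form
    _⇒_  : Form → Form → Form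
    □    : 𝕀 → Form → Form
    [∩_] : Index → Form → Form
    [∪⁺_] : Index → Form → Form

  infixr 5 _⇒_
  infix 6 ~_

  _∧ᶠ_ : Form → Form → Form
  φ ∧ᶠ ψ = ~ (φ ⇒ ~ ψ)

  _⇔_ : Form → Form → Form
  φ ⇔ ψ = (φ ⇒ ψ) ∧ᶠ (ψ ⇒ φ)

  ⋀ : (𝕀 → Form) → Index → Form
  ⋀ f (x ∷ xs) = go x xs
    where
    go : 𝕀 → List 𝕀 → Form
    go x []       = f x
    go x (y ∷ ys) = f x ∧ᶠ go y ys

  evalB : (Form → Bool) → Form → Bool
  evalB v (~ φ)   = not (evalB v φ)
  evalB v (φ ⇒ ψ) = not (evalB v φ) ∨ evalB v ψ
  evalB v φ@(var _)     = v φ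
  evalB v φ@(□ _ _)     = v φ
  evalB v φ@([∩ _ ] _)  = v φ
  evalB v φ@([∪⁺ _ ] _) = v φ

  Taut : Form → Set
  Taut φ = ∀ (v : Form → Bool) → evalB v φ ≡ true

  data Extra : Sys → Form → Set where
    D-ax  : ∀ {i φ} → Extra D (□ i φ ⇒ ~ □ i (~ φ))
    T-ax  : ∀ {X i φ} → ExtendsT X → Extra X (□ i φ ⇒ φ)
    T∩-ax : ∀ {X I φ} → ExtendsT X → Extra X ([∩ I ] φ ⇒ φ)
    B-ax  : ∀ {i φ} → Extra B (~ φ ⇒ □ i (~ □ i φ))
    B∩-ax : ∀ {I φ} → Extra B (~ φ ⇒ [∩ I ] (~ [∩ I ] φ))
    4-ax  : ∀ {i φ} → Extra S4 (□ i φ ⇒ □ i (□ i φ))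
    4∩-ax : ∀ {I φ} → Extra S4 ([∩ I ] φ ⇒ [∩ I ] ([∩ I ] φ))
    5-ax  : ∀ {i φ} → Extra S5 (~ □ i φ ⇒ □ i (~ □ i φ))
    5∩-ax : ∀ {I φ} → Extra S5 (~ [∩ I ] φ ⇒ [∩ I ] (~ [∩ I ] φ))

  data ⊢[_]_ (X : Sys) : Form → Set where
    taut : ∀ {φ} → Taut φ → ⊢[ X ] φ
    mp   : ∀ {φ ψ} → ⊢[ X ] (φ ⇒ ψ) → ⊢[ X ] φ → ⊢[ X ] ψ
    ax-K : ∀ {i φ ψ} → ⊢[ X ] (□ i (φ ⇒ ψ) ⇒ (□ i φ ⇒ □ i ψ))
    nec  : ∀ {i φ} → ⊢[ X ] φ → ⊢[ X ] □ i φ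
    ax-K∩ : ∀ {I φ ψ} → ⊢[ X ] ([∩ I ] (φ ⇒ ψ) ⇒ ([∩ I ] φ ⇒ [∩ I ] ψ))
    nec∩ : ∀ {I φ} → ⊢[ X ] φ → ⊢[ X ] [∩ I ] φ
    ax-∩1 : ∀ {i φ} → ⊢[ X ] (□ i φ ⇔ [∩ i ∷ [] ] φ)
    ax-∩2 : ∀ {I J φ} → I ⊆ᴵ J → ⊢[ X ] ([∩ I ] φ ⇒ [∩ J ] φ)
    ax-K∪ : ∀ {I φ ψ} → ⊢[ X ] ([∪⁺ I ] (φ ⇒ ψ) ⇒ ([∪⁺ I ] φ ⇒ [∪⁺ I ] ψ))
    ax-∪1 : ∀ {I i φ} → i ∈ᴵ I → ⊢[ X ] ([∪⁺ I ] φ ⇒ □ i (φ ∧ᶠ [∪⁺ I ] φ))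
    rule-∪2 : ∀ {I φ ψ} → ⊢[ X ] (φ ⇒ ⋀ (λ i → □ i (φ ∧ᶠ ψ)) I) → ⊢[ X ] (φ ⇒ [∪⁺ I ] ψ)
    extra : ∀ {φ} → Extra X φ → ⊢[ X ] φ

  record Model : Set₁ where
    field
      S   : Set
      nonempty : S
      R   : 𝕀 → Rel S 0ℓ
      V   : ℕ → S → Set

  module _ (M : Model) where
    open Model M

    R∩ : Index → Rel S 0ℓ
    R∩ I s t = ∀ i → i ∈ᴵ I → R i s t

    R∪ : Index → Rel S 0ℓ
    R∪ I s t = Σ 𝕀 λ i → i ∈ᴵ I × R i s t

    R∪⁺ : Index → Rel S 0ℓ
    R∪⁺ I = TransClosure (R∪ I)

    _⊨_ : S → Form → Set
    s ⊨ (var p) = V p s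
    s ⊨ (~ φ) = ¬ (s ⊨ φ)
    s ⊨ (φ ⇒ ψ) = (s ⊨ φ) → (s ⊨ ψ)
    s ⊨ (□ i φ) = ∀ t → R i s t → (t ⊨ φ)
    s ⊨ ([∩ I ] φ) = ∀ t → R∩ I s t → (t ⊨ φ)
    s ⊨ ([∪⁺ I ] φ) = ∀ t → R∪⁺ I s t → (t ⊨ φ)

  Serial : {S : Set} → Rel S 0ℓ → Set
  Serial {S} r = ∀ (s : S) → ∃ λ t → r s t

  InClass : Sys → Model → Set
  InClass K  M = ⊤
  InClass D  M = ∀ i → Serial (Model.R M i)
  InClass T  M = ∀ i → Reflexive (Model.R M i)
  InClass B  M = ∀ i → Reflexive (Model.R M i) × Symmetric (Model.R M i)
  InClass S4 M = ∀ i → Reflexive (Model.R M i) × Transitive (Model.R M i)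
  InClass S5 M = ∀ i → IsEquivalence (Model.R M i)

  Valid : Sys → Form → Set₁
  Valid X φ = ∀ (M : Model) → InClass X M → ∀ (s : Model.S M) → _⊨_ M s φ

{-# OPTIONS --safe #-}
module Submission where

open import Defs
open import Level using (0ℓ)
open import Data.Nat as ℕ using (ℕ; suc; _≤_; _<_)
import Data.Nat.Properties as ℕ
open import Data.Bool using (Bool; true; false; not; _∨_; if_then_else_)
import Data.Bool.Properties as Bool
open import Data.Maybe using (Maybe; just; nothing; zipWith)
open import Data.List using (List; []; _∷_; _++_; map; foldr; filter; concatMap; length)
import Data.List.Properties as List
open import Data.List.NonEmpty using (_∷_; toList; head)
open import Data.List.Relation.Unary.Any as Any using (Any; here; there; any?; _─_)
open import Data.List.Relation.Unary.All as All using (All; []; _∷_; all?)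
import Data.List.Relation.Unary.All.Properties as All
open import Data.List.Membership.Propositional using (_∈_; find; lose)
open import Data.List.Membership.Propositional.Properties
  using (∈-map⁺; ∈-filter⁺; ∈-filter⁻; ∈-++⁺ˡ; ∈-++⁺ʳ; ∈-++⁻; ∈-concatMap⁺)
open import Data.List.Relation.Binary.Subset.Propositional using (_⊆_)
open import Data.Product using (∃-syntax; _×_; _,_; proj₁; proj₂; map₂)
open import Data.Sum as Sum using (_⊎_; inj₁; inj₂)
open import Data.Empty using (⊥)
open import Data.Unit using (⊤; tt)
open import Function using (_∘_; id; _on_)
open import Relation.Nullary using (¬_; Dec; yes; no; does; contradiction)
open import Relation.Nullary.Decidable using (map′; dec⇒maybe; _×-dec_; _→-dec_; decidable-stable)
open import Relation.Binary using (Rel; DecidableEquality)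
open import Relation.Binary.PropositionalEquality using (_≡_; refl; sym; trans; cong; cong₂; isEquivalence)
import Relation.Binary.Construct.On as On
open import Relation.Binary.Construct.Closure.Transitive using ([_]; _∷_)

-- Argue constructively with the finitely many truth assignments to the prime subformulas of φ.
-- Assignments whose characteristic formula is refutable are discarded until every survivor has
-- the successors, within the survivors, that its false modal formulas require: when a survivor
-- lacks one, the derivability of all discarded negations yields a refutation of it (through
-- necessitation for [∩ I ], through the induction rule for [∪⁺ I ]). The survivors are then
-- unravelled into a tree with edges labelled by indices, on which R i is the closure, in the sense
-- of X, of the edges whose label contains i. Truth at a world of this tree agrees with the assignment it
-- carries, so a valid φ holds under every survivor; since the other assignments are refuted, φ is derivable.

-- Case distinction and elimination over finite lists.

-- Stands in for excluded middle: a choice at each element yields the first exception or a uniform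
-- proof.
∀-⊎ : ∀ {A P : Set} {Q : A → Set} (xs : List A) →
      (∀ {x} → x ∈ xs → P ⊎ Q x) → P ⊎ (∀ {x} → x ∈ xs → Q x)
∀-⊎ []       f = inj₂ λ ()
∀-⊎ (x ∷ xs) f with f (here refl) | ∀-⊎ xs (f ∘ there)
... | inj₁ p | _      = inj₁ p
... | inj₂ q | inj₁ p = inj₁ p
... | inj₂ q | inj₂ g = inj₂ λ { (here refl) → q ; (there m) → g m }

∈-─ : ∀ {A : Set} {x y : A} {xs} (p : x ∈ xs) → y ∈ xs → y ≡ x ⊎ y ∈ (xs ─ p)
∈-─ (here refl) (here refl) = inj₁ refl
∈-─ (here refl) (there q)   = inj₂ q
∈-─ (there p)   (here refl) = inj₂ (here refl)
∈-─ (there p)   (there q)   = Sum.map₂ there (∈-─ p q)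

module _ {A : Set} (xs : List A) (Bad : A → Set) where

  Cover : List A → Set
  Cover ys = ∀ {x} → x ∈ xs → Bad x ⊎ x ∈ ys

  -- Each round shortens the list, so the loop ends. `judge` may use that whatever has left the list
  -- is bad, so each removal can rest on the earlier ones.
  eliminate : (Good : List A → A → Set) →
              (∀ ys → Cover ys → ∀ {y} → y ∈ ys → Bad y ⊎ Good ys y) →
              ∃[ ys ] Cover ys × (∀ {y} → y ∈ ys → Good ys y)
  eliminate Good judge = loop (length xs) xs refl inj₂
    where
    loop : ∀ n ys → length ys ≡ n → Cover ys → ∃[ zs ] Cover zs × (∀ {y} → y ∈ zs → Good zs y)
    loop n ys len cover
      with ∀-⊎ {P = ∃[ y ] y ∈ ys × Bad y} ys (λ m → Sum.map₁ (λ bad → _ , m , bad) (judge ys cover m))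
    ... | inj₂ good = ys , cover , good
    loop ℕ.zero (_ ∷ _) () cover | inj₁ _
    loop (suc n) ys len cover | inj₁ (y , m , bad) =
      loop n (ys ─ m)
        (ℕ.suc-injective (trans (sym (List.length-removeAt′ ys (Any.index m))) len))
        λ p → Sum.[ inj₁ , (λ q → Sum.map₁ (λ { refl → bad }) (∈-─ m q)) ] (cover p)

-- Prime subformulas and the constraints of modalities.

module Syntax (𝕀 : Set) where

  open Lang 𝕀

  -- Modal formulas count as atoms, yet the primes in their scope are listed too, so that
  -- assignments to them also settle the arguments of modalities.
  primes : Form → List Form
  primes (var p)          = var p ∷ []
  primes (~ φ)            = primes φ
  primes (φ ⇒ ψ)          = primes φ ++ primes ψ
  primes σ@(□ _ χ)        = σ ∷ primes χ
  primes σ@([∩ _ ] χ)     = σ ∷ primes χ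
  primes σ@([∪⁺ _ ] χ)    = σ ∷ primes χ

  primes-trans : ∀ φ {σ} → σ ∈ primes φ → primes σ ⊆ primes φ
  primes-trans (var _)     (here refl) = id
  primes-trans (~ φ)       m           = primes-trans φ m
  primes-trans (φ ⇒ ψ)     m with ∈-++⁻ (primes φ) m
  ... | inj₁ m′ = ∈-++⁺ˡ ∘ primes-trans φ m′
  ... | inj₂ m′ = ∈-++⁺ʳ (primes φ) ∘ primes-trans ψ m′
  primes-trans (□ _ _)     (here refl) = id
  primes-trans (□ _ χ)     (there m)   = there ∘ primes-trans χ m
  primes-trans ([∩ _ ] _)  (here refl) = id
  primes-trans ([∩ _ ] χ)  (there m)   = there ∘ primes-trans χ m
  primes-trans ([∪⁺ _ ] _) (here refl) = id
  primes-trans ([∪⁺ _ ] χ) (there m)   = there ∘ primes-trans χ m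

  -- Trig J σ says that the modality of σ constrains [∩ J ]-successors, and then σ entails
  -- [∩ J ] (body σ).
  Trig : Index → Form → Set
  Trig J (□ i _)     = i ∈ᴵ J
  Trig J ([∩ I ] _)  = I ⊆ᴵ J
  Trig J ([∪⁺ I ] _) = Any (_∈ᴵ J) (toList I)
  Trig J _           = ⊥

  Trig-mono : ∀ {I J} → I ⊆ᴵ J → ∀ σ → Trig I σ → Trig J σ
  Trig-mono s (□ i _)     t = s i t
  Trig-mono s ([∩ I ] _)  t = λ i → s i ∘ t i
  Trig-mono s ([∪⁺ I ] _) t = Any.map (s _) t

  -- Under `[∪⁺_]` the formula repeats itself, as in axiom ∪1, so that the obligation travels along
  -- a chain of successors.
  body : Form → Form
  body (□ _ χ)          = χ
  body ([∩ _ ] χ)       = χ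
  body σ@([∪⁺ _ ] χ)    = χ ∧ᶠ σ
  body σ                = σ

  mentions : Form → List 𝕀
  mentions (□ i _)     = i ∷ []
  mentions ([∩ I ] _)  = toList I
  mentions ([∪⁺ I ] _) = toList I
  mentions _           = []

module Completeness (𝕀 : Set) (𝕀-countable : AtMostCountable 𝕀) where

  open Lang 𝕀
  open Syntax 𝕀

  infix 4 _≟ᴵ_ _∈ᴵ?_ _⊆ᴵ?_ _≟ᴵˣ_ _≟ᶠ_ _⊩_ _⊩?_

  -- Decidable equality.

  _≟ᴵ_ : DecidableEquality 𝕀
  i ≟ᴵ j = map′ (proj₂ 𝕀-countable) (cong (proj₁ 𝕀-countable)) (proj₁ 𝕀-countable i ℕ.≟ proj₁ 𝕀-countable j)

  _∈ᴵ?_ : ∀ i I → Dec (i ∈ᴵ I)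
  i ∈ᴵ? I = any? (i ≟ᴵ_) (toList I)

  _⊆ᴵ?_ : ∀ I J → Dec (I ⊆ᴵ J)
  I ⊆ᴵ? J = map′ (λ a _ → All.lookup a) (λ f → All.tabulate (f _)) (all? (_∈ᴵ? J) (toList I))

  _≟ᴵˣ_ : DecidableEquality Index
  (i ∷ is) ≟ᴵˣ (j ∷ js) =
    map′ (λ { (refl , refl) → refl }) (λ { refl → refl , refl }) ((i ≟ᴵ j) ×-dec List.≡-dec _≟ᴵ_ is js)

  -- Testing with a catch-all clause first avoids the thirty off-diagonal cases of _≟ᶠ_.
  same? : (φ ψ : Form) → Maybe (φ ≡ ψ)
  same? (var p)     (var q)      = Data.Maybe.map (cong var) (dec⇒maybe (p ℕ.≟ q))
  same? (~ φ)       (~ ψ)        = Data.Maybe.map (cong ~_) (same? φ ψ)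
  same? (φ ⇒ χ)     (ψ ⇒ ω)      = zipWith (cong₂ _⇒_) (same? φ ψ) (same? χ ω)
  same? (□ i φ)     (□ j ψ)      = zipWith (cong₂ □) (dec⇒maybe (i ≟ᴵ j)) (same? φ ψ)
  same? ([∩ I ] φ)  ([∩ J ] ψ)   = zipWith (cong₂ [∩_]) (dec⇒maybe (I ≟ᴵˣ J)) (same? φ ψ)
  same? ([∪⁺ I ] φ) ([∪⁺ J ] ψ)  = zipWith (cong₂ [∪⁺_]) (dec⇒maybe (I ≟ᴵˣ J)) (same? φ ψ)
  same? _           _            = nothing

  dec⇒maybe-refl : ∀ {A : Set} (_≟_ : DecidableEquality A) x → ∃[ e ] dec⇒maybe (x ≟ x) ≡ just e
  dec⇒maybe-refl _≟_ x with x ≟ x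
  ... | yes e = e , refl
  ... | no ¬e = contradiction refl ¬e

  same?-refl : ∀ φ → ∃[ e ] same? φ φ ≡ just e
  same?-refl (var p) rewrite proj₂ (dec⇒maybe-refl ℕ._≟_ p) = _ , refl
  same?-refl (~ φ) rewrite proj₂ (same?-refl φ) = _ , refl
  same?-refl (φ ⇒ ψ) rewrite proj₂ (same?-refl φ) | proj₂ (same?-refl ψ) = _ , refl
  same?-refl (□ i φ) rewrite proj₂ (dec⇒maybe-refl _≟ᴵ_ i) | proj₂ (same?-refl φ) = _ , refl
  same?-refl ([∩ I ] φ) rewrite proj₂ (dec⇒maybe-refl _≟ᴵˣ_ I) | proj₂ (same?-refl φ) = _ , refl
  same?-refl ([∪⁺ I ] φ) rewrite proj₂ (dec⇒maybe-refl _≟ᴵˣ_ I) | proj₂ (same?-refl φ) = _ , refl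

  _≟ᶠ_ : DecidableEquality Form
  φ ≟ᶠ ψ with same? φ ψ in eq
  ... | just e  = yes e
  ... | nothing = no λ { refl → contradiction (trans (sym eq) (proj₂ (same?-refl φ))) λ () }

  -- Truth assignments and Boolean reasoning.

  Val : Set
  Val = Form → Bool

  -- A record, unlike the bare equation, determines v and φ by unification.
  record _⊩_ (v : Val) (φ : Form) : Set where
    constructor ⟨_⟩
    field eval : evalB v φ ≡ true
  open _⊩_

  _⊩?_ : ∀ v φ → Dec (v ⊩ φ)
  v ⊩? φ = map′ ⟨_⟩ eval (evalB v φ Bool.≟ true)

  module _ {v : Val} where

    ⇒-intro : ∀ {φ ψ} → (v ⊩ φ → v ⊩ ψ) → v ⊩ φ ⇒ ψ
    ⇒-intro {φ} f with evalB v φ in eq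
    ... | true  = ⟨ trans (cong (λ b → not b ∨ _) eq) (eval (f ⟨ eq ⟩)) ⟩
    ... | false = ⟨ cong (λ b → not b ∨ _) eq ⟩

    ⇒-elim : ∀ {φ ψ} → v ⊩ φ ⇒ ψ → v ⊩ φ → v ⊩ ψ
    ⇒-elim ⟨ h ⟩ ⟨ p ⟩ = ⟨ trans (cong (λ b → not b ∨ _) (sym p)) h ⟩

    ~-intro : ∀ {φ} → ¬ v ⊩ φ → v ⊩ ~ φ
    ~-intro h = ⟨ cong not (Bool.¬-not (h ∘ ⟨_⟩)) ⟩

    ~-elim : ∀ {φ} → v ⊩ ~ φ → ¬ v ⊩ φ
    ~-elim ⟨ h ⟩ ⟨ p ⟩ = contradiction (trans (sym (cong not p)) h) λ ()

    by-contra : ∀ {φ} → ¬ v ⊩ ~ φ → v ⊩ φ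
    by-contra {φ} h = decidable-stable (v ⊩? φ) (h ∘ ~-intro)

    ∧-intro : ∀ {φ ψ} → v ⊩ φ → v ⊩ ψ → v ⊩ φ ∧ᶠ ψ
    ∧-intro p q = ~-intro λ r → ~-elim (⇒-elim r p) q

    ∧-elim₁ : ∀ {φ ψ} → v ⊩ φ ∧ᶠ ψ → v ⊩ φ
    ∧-elim₁ h = by-contra λ p → ~-elim h (⇒-intro λ q → contradiction q (~-elim p))

    ∧-elim₂ : ∀ {φ ψ} → v ⊩ φ ∧ᶠ ψ → v ⊩ ψ
    ∧-elim₂ h = by-contra λ p → ~-elim h (⇒-intro λ _ → p)

    ⊩⊤ : ∀ {φ} → v ⊩ φ ⇒ φ
    ⊩⊤ = ⇒-intro id

  contra~ : ∀ {v w φ ψ} → (v ⊩ ~ φ → w ⊩ ~ ψ) → w ⊩ ψ → v ⊩ φ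
  contra~ f p = by-contra λ q → ~-elim (f q) p

  infixr 5 _⇛_

  _⇛_ : List Form → Form → Form
  Γ ⇛ φ = foldr _⇒_ φ Γ

  ⇛-intro : ∀ {v} Γ {φ} → (All (v ⊩_) Γ → v ⊩ φ) → v ⊩ Γ ⇛ φ
  ⇛-intro []      f = f []
  ⇛-intro (γ ∷ Γ) f = ⇒-intro λ p → ⇛-intro Γ (f ∘ (p ∷_))

  ⊤ᶠ ⊥ᶠ : Form
  ⊤ᶠ = var 0 ⇒ var 0
  ⊥ᶠ = ~ ⊤ᶠ

  -- The condition is settled at `v` while the formula is built; only the outcome is evaluated at
  -- other assignments.
  when : Val → Form → Form → Form
  when v φ ψ = if evalB v φ then ψ else ⊤ᶠ

  when-intro : ∀ v φ {w ψ} → (v ⊩ φ → w ⊩ ψ) → w ⊩ when v φ ψ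
  when-intro v φ f with evalB v φ in eq
  ... | true  = f ⟨ eq ⟩
  ... | false = ⊩⊤

  when-elim : ∀ v φ {w ψ} → w ⊩ when v φ ψ → v ⊩ φ → w ⊩ ψ
  when-elim v φ h ⟨ p ⟩ rewrite p = h

  ⋀ᴸ ⋁ᴸ : List Form → Form
  ⋀ᴸ []      = ⊤ᶠ
  ⋀ᴸ (γ ∷ Γ) = γ ∧ᶠ ⋀ᴸ Γ
  ⋁ᴸ = foldr (λ φ ψ → ~ φ ⇒ ψ) ⊥ᶠ

  ⋀ᴸ-intro : ∀ {v Γ} → All (v ⊩_) Γ → v ⊩ ⋀ᴸ Γ
  ⋀ᴸ-intro []       = ⊩⊤
  ⋀ᴸ-intro (p ∷ ps) = ∧-intro p (⋀ᴸ-intro ps)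

  ⋀ᴸ-elim : ∀ {v} Γ → v ⊩ ⋀ᴸ Γ → All (v ⊩_) Γ
  ⋀ᴸ-elim []      h = []
  ⋀ᴸ-elim (γ ∷ Γ) h = ∧-elim₁ h ∷ ⋀ᴸ-elim Γ (∧-elim₂ h)

  ⋁ᴸ-intro : ∀ {v γ Γ} → γ ∈ Γ → v ⊩ γ → v ⊩ ⋁ᴸ Γ
  ⋁ᴸ-intro (here refl) p = ⇒-intro λ q → contradiction p (~-elim q)
  ⋁ᴸ-intro (there m)   p = ⇒-intro λ _ → ⋁ᴸ-intro m p

  ⋁ᴸ-elim : ∀ {v φ} Γ → (∀ {γ} → γ ∈ Γ → v ⊩ γ → v ⊩ φ) → v ⊩ ⋁ᴸ Γ → v ⊩ φ
  ⋁ᴸ-elim []      f h = contradiction ⊩⊤ (~-elim h)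
  ⋁ᴸ-elim {v} (γ ∷ Γ) f h with v ⊩? γ
  ... | yes p = f (here refl) p
  ... | no ¬p = ⋁ᴸ-elim Γ (f ∘ there) (⇒-elim h (~-intro ¬p))

  -- Derivations in the six systems.

  module _ {X : Sys} where

    private
      ⊢_ : Form → Set
      ⊢_ = ⊢[ X ]_

    tautology : ∀ {φ} → (∀ {v} → v ⊩ φ) → ⊢ φ
    tautology sem = taut λ v → eval sem

    -- `Γ ⇛ φ` is a tautology and modus ponens detaches its premises, so propositional steps can be
    -- argued semantically.
    consequence : ∀ {Γ φ} → All ⊢_ Γ → (∀ {v} → All (v ⊩_) Γ → v ⊩ φ) → ⊢ φ
    consequence {Γ} {φ} ⊢Γ sem = detach ⊢Γ (tautology (⇛-intro Γ sem))
      where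
      detach : ∀ {Γ} → All ⊢_ Γ → ⊢ (Γ ⇛ φ) → ⊢ φ
      detach []       d = d
      detach (p ∷ ps) d = detach ps (mp d p)

    infixr 6 _⨾_

    _⨾_ : ∀ {φ ψ χ} → ⊢ (φ ⇒ ψ) → ⊢ (ψ ⇒ χ) → ⊢ (φ ⇒ χ)
    p ⨾ q = consequence (p ∷ q ∷ []) λ { (a ∷ b ∷ []) → ⇒-intro λ x → ⇒-elim b (⇒-elim a x) }

    weaken : ∀ {φ ψ} → ⊢ ψ → ⊢ (φ ⇒ ψ)
    weaken p = consequence (p ∷ []) λ { (a ∷ []) → ⇒-intro λ _ → a }

    contrapose : ∀ {φ ψ} → ⊢ (φ ⇒ ψ) → ⊢ (~ ψ ⇒ ~ φ)
    contrapose p = consequence (p ∷ []) λ { (a ∷ []) →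
      ⇒-intro λ x → ~-intro λ y → ~-elim x (⇒-elim a y) }

    ∧⇒₁ : ∀ {φ ψ} → ⊢ (φ ∧ᶠ ψ ⇒ φ)
    ∧⇒₁ = tautology (⇒-intro ∧-elim₁)

    ∧⇒₂ : ∀ {φ ψ} → ⊢ (φ ∧ᶠ ψ ⇒ ψ)
    ∧⇒₂ = tautology (⇒-intro ∧-elim₂)

    ~~⇒ : ∀ {φ} → ⊢ (~ ~ φ ⇒ φ)
    ~~⇒ = tautology (⇒-intro λ x → by-contra (~-elim x))

    ⇒~~ : ∀ {φ} → ⊢ (φ ⇒ ~ ~ φ)
    ⇒~~ = tautology (⇒-intro λ x → ~-intro λ y → ~-elim y x)

    ∩-mono : ∀ {J φ ψ} → ⊢ (φ ⇒ ψ) → ⊢ ([∩ J ] φ ⇒ [∩ J ] ψ)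
    ∩-mono p = mp ax-K∩ (nec∩ p)

    ∩-⇛ : ∀ {J x φ} Γ → ⊢ (x ⇒ [∩ J ] (Γ ⇛ φ)) → All (λ γ → ⊢ (x ⇒ [∩ J ] γ)) Γ → ⊢ (x ⇒ [∩ J ] φ)
    ∩-⇛ []      d []       = d
    ∩-⇛ (γ ∷ Γ) d (p ∷ ps) = ∩-⇛ Γ
      (consequence (d ⨾ ax-K∩ ∷ p ∷ []) λ { (a ∷ b ∷ []) →
        ⇒-intro λ y → ⇒-elim (⇒-elim a y) (⇒-elim b y) })
      ps

    ∩-∧ : ∀ {J x φ ψ} → ⊢ (x ⇒ [∩ J ] φ) → ⊢ (x ⇒ [∩ J ] ψ) → ⊢ (x ⇒ [∩ J ] (φ ∧ᶠ ψ))
    ∩-∧ {φ = φ} {ψ} p q = ∩-⇛ (φ ∷ ψ ∷ [])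
      (weaken (nec∩ (tautology (⇒-intro λ a → ⇒-intro λ b → ∧-intro a b)))) (p ∷ q ∷ [])

    ∩⇒□ : ∀ {i φ} → ⊢ ([∩ i ∷ [] ] φ ⇒ □ i φ)
    ∩⇒□ = mp ∧⇒₂ ax-∩1

    □⇒∩ : ∀ {i J φ} → i ∈ᴵ J → ⊢ (□ i φ ⇒ [∩ J ] φ)
    □⇒∩ m = mp ∧⇒₁ ax-∩1 ⨾ ax-∩2 λ { _ (here refl) → m }

    ⊢⋀-intro : ∀ i is {f χ} → (∀ {j} → j ∈ i ∷ is → ⊢ (χ ⇒ f j)) → ⊢ (χ ⇒ ⋀ f (i ∷ is))
    ⊢⋀-intro i []       h = h (here refl)
    ⊢⋀-intro i (j ∷ js) h = consequence (h (here refl) ∷ ⊢⋀-intro j js (h ∘ there) ∷ []) λ { (a ∷ b ∷ []) →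
      ⇒-intro λ x → ∧-intro (⇒-elim a x) (⇒-elim b x) }

    ⊢⋁-elim : ∀ {Γ χ} → All (λ γ → ⊢ (γ ⇒ χ)) Γ → ⊢ (⋁ᴸ Γ ⇒ χ)
    ⊢⋁-elim []       = tautology (⇒-intro λ b → contradiction ⊩⊤ (~-elim b))
    ⊢⋁-elim {γ ∷ Γ} (p ∷ ps) = consequence (p ∷ ⊢⋁-elim ps ∷ []) λ { (a ∷ b ∷ []) →
      ⇒-intro (⋁ᴸ-elim (γ ∷ Γ) λ { (here refl) x → ⇒-elim a x
                                 ; (there m)   x → ⇒-elim b (⋁ᴸ-intro m x) }) }

    ∩-T : ∀ {J φ} → ExtendsT X → ⊢ ([∩ J ] φ ⇒ φ)
    ∩-T = extra ∘ T∩-ax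

  data Symmetrical : Sys → Set where
    B  : Symmetrical B
    S5 : Symmetrical S5

  data Transitional : Sys → Set where
    S4 : Transitional S4
    S5 : Transitional S5

  ∩-B : ∀ {X J φ} → Symmetrical X → ⊢[ X ] (~ φ ⇒ [∩ J ] (~ [∩ J ] φ))
  ∩-B B  = extra B∩-ax
  ∩-B S5 = contrapose (∩-T tt) ⨾ extra 5∩-ax

  ∩-4 : ∀ {X J φ} → Transitional X → ⊢[ X ] ([∩ J ] φ ⇒ [∩ J ] ([∩ J ] φ))
  ∩-4 S4 = extra 4∩-ax
  -- T contraposed gives `~ [∩ J ] (~ [∩ J ] φ)`, 5 boxes it, and 5 contraposed turns it back into
  -- `[∩ J ] φ` under the box.
  ∩-4 S5 = ⇒~~ ⨾ contrapose (∩-T tt) ⨾ extra 5∩-ax ⨾ ∩-mono (contrapose (extra 5∩-ax) ⨾ ~~⇒)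

  Trig? : ∀ J σ → Dec (Trig J σ)
  Trig? J (var _)     = no λ ()
  Trig? J (~ _)       = no λ ()
  Trig? J (_ ⇒ _)     = no λ ()
  Trig? J (□ i _)     = i ∈ᴵ? J
  Trig? J ([∩ I ] _)  = I ⊆ᴵ? J
  Trig? J ([∪⁺ I ] _) = any? (_∈ᴵ? J) (toList I)

  unfold : ∀ {X J} σ → Trig J σ → ⊢[ X ] (σ ⇒ [∩ J ] (body σ))
  unfold (□ _ _)     t = □⇒∩ t
  unfold ([∩ _ ] _)  t = ax-∩2 t
  -- ∪1 applies at a type common to both indices, and the resulting box lifts to `[∩ J ]`.
  unfold ([∪⁺ _ ] _) t with i , m , m′ ← find t = ax-∪1 m ⨾ □⇒∩ m′

  unfold-T : ∀ {X} σ → ExtendsT X → ⊢[ X ] (σ ⇒ body σ)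
  unfold-T (□ _ _)           e = extra (T-ax e)
  unfold-T ([∩ _ ] _)        e = extra (T∩-ax e)
  unfold-T ([∪⁺ i ∷ _ ] _)   e = ax-∪1 (here refl) ⨾ extra (T-ax e)
  unfold-T (var _)           e = tautology ⊩⊤
  unfold-T (~ _)             e = tautology ⊩⊤
  unfold-T (_ ⇒ _)           e = tautology ⊩⊤

  unfold-B : ∀ {X J} σ → Symmetrical X → Trig J σ → ⊢[ X ] (~ body σ ⇒ [∩ J ] (~ σ))
  unfold-B σ s t = ∩-B s ⨾ ∩-mono (contrapose (unfold σ t))

  unfold-4 : ∀ {X J} σ → Transitional X → Trig J σ → ⊢[ X ] (σ ⇒ [∩ J ] σ)
  unfold-4 (□ i _)     s t = □⇒∩ {J = i ∷ []} (here refl) ⨾ ∩-4 s ⨾ ∩-mono ∩⇒□ ⨾ ax-∩2 {I = i ∷ []} λ { _ (here refl) → t }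
  unfold-4 ([∩ _ ] _)  s t = ∩-4 s ⨾ ax-∩2 t
  unfold-4 ([∪⁺ _ ] _) s t = unfold _ t ⨾ ∩-mono ∧⇒₂

  -- B gives `[∩ J ] (~ [∩ J ] σ)`, and `unfold-4` contraposed works under the box. This covers
  -- `[∪⁺_]`, which has no axiom 5 of its own.
  unfold-5 : ∀ {J} σ → Trig J σ → ⊢[ S5 ] (~ σ ⇒ [∩ J ] (~ σ))
  unfold-5 σ t = ∩-B S5 ⨾ ∩-mono (contrapose (unfold-4 σ S5 t))

  -- Enumeration of assignments, and demands on successors.

  Prime : Form → Set
  Prime σ = ∀ v → evalB v σ ≡ v σ

  primes-Prime : ∀ φ → All Prime (primes φ)
  primes-Prime (var _)     = (λ _ → refl) ∷ []
  primes-Prime (~ φ)       = primes-Prime φ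
  primes-Prime (φ ⇒ ψ)     = All.++⁺ (primes-Prime φ) (primes-Prime ψ)
  primes-Prime (□ _ χ)     = (λ _ → refl) ∷ primes-Prime χ
  primes-Prime ([∩ _ ] χ)  = (λ _ → refl) ∷ primes-Prime χ
  primes-Prime ([∪⁺ _ ] χ) = (λ _ → refl) ∷ primes-Prime χ

  Agree : List Form → Val → Val → Set
  Agree Σ v w = ∀ {σ} → σ ∈ Σ → evalB v σ ≡ evalB w σ

  update : Form → Bool → Val → Val
  update σ b v τ = if does (τ ≟ᶠ σ) then b else v τ

  valuations : List Form → List Val
  valuations []      = (λ _ → false) ∷ []
  valuations (σ ∷ Σ) = map (update σ true) (valuations Σ) ++ map (update σ false) (valuations Σ)

  valuations-complete : ∀ {Σ} → All Prime Σ → ∀ w → ∃[ v ] v ∈ valuations Σ × Agree Σ v w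
  valuations-complete []                   w = _ , here refl , λ ()
  valuations-complete {σ ∷ Σ} (p ∷ ps) w with v , m , agree ← valuations-complete ps w =
    update σ (evalB w σ) v , updated , agree′
    where
    updated : update σ (evalB w σ) v ∈ valuations (σ ∷ Σ)
    updated with evalB w σ
    ... | true  = ∈-++⁺ˡ (∈-map⁺ _ m)
    ... | false = ∈-++⁺ʳ _ (∈-map⁺ _ m)
    agree′ : Agree (σ ∷ Σ) (update σ (evalB w σ) v) w
    agree′ {τ} m with All.lookup (p ∷ ps) m (update σ (evalB w σ) v) | m
    ... | e | here refl with σ ≟ᶠ σ
    ...   | yes _ = e
    ...   | no ¬e = contradiction refl ¬e
    agree′ {τ} m | e | there m′ with τ ≟ᶠ σ
    ...   | yes refl = e
    ...   | no _     = trans e (trans (sym (All.lookup ps m′ v)) (agree m′))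

  -- What the truth value of σ at v imposes on the successors that σ constrains. The clauses for
  -- B, S4 and S5 are chosen so that accessibility comes out symmetric, transitive, or both.
  demand : Sys → Val → Form → Form
  demand B  v σ = when v σ (body σ) ∧ᶠ when v (~ body σ) (~ σ)
  demand S4 v σ = when v σ σ
  demand S5 v σ = when v σ σ ∧ᶠ when v (~ σ) (~ σ)
  demand _  v σ = when v σ (body σ)

  -- S4 and S5 demand `σ` itself; the body is then recovered at `w` by reflexivity.
  demand-body : ∀ X {v w} σ → (ExtendsT X → w ⊩ σ → w ⊩ body σ) → w ⊩ demand X v σ → v ⊩ σ → w ⊩ body σ
  demand-body K  {v} σ r d p = when-elim v σ d p
  demand-body D  {v} σ r d p = when-elim v σ d p
  demand-body T  {v} σ r d p = when-elim v σ d p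
  demand-body B  {v} σ r d p = when-elim v σ (∧-elim₁ d) p
  demand-body S4 {v} σ r d p = r tt (when-elim v σ d p)
  demand-body S5 {v} σ r d p = r tt (when-elim v σ (∧-elim₁ d) p)

  demand-refl : ∀ X {v} σ → ExtendsT X → (v ⊩ σ → v ⊩ body σ) → v ⊩ demand X v σ
  demand-refl T  {v} σ e r = when-intro v σ r
  demand-refl B  {v} σ e r = ∧-intro (when-intro v σ r) (when-intro v (~ body σ) λ p → ~-intro (~-elim p ∘ r))
  demand-refl S4 {v} σ e r = when-intro v σ id
  demand-refl S5 {v} σ e r = ∧-intro (when-intro v σ id) (when-intro v (~ σ) id)

  -- Exchanging `v` and `w` turns each conjunct of the demand into the contrapositive of the other.
  demand-sym : ∀ {X v w} σ → Symmetrical X → w ⊩ demand X v σ → v ⊩ demand X w σ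
  demand-sym {v = v} {w} σ B d = ∧-intro
    (when-intro w σ (contra~ (when-elim v (~ body σ) (∧-elim₂ d))))
    (when-intro w (~ body σ) λ p → ~-intro (~-elim p ∘ when-elim v σ (∧-elim₁ d)))
  demand-sym {v = v} {w} σ S5 d = ∧-intro
    (when-intro w σ (contra~ (when-elim v (~ σ) (∧-elim₂ d))))
    (when-intro w (~ σ) λ p → ~-intro (~-elim p ∘ when-elim v σ (∧-elim₁ d)))

  demand-trans : ∀ {X u v w} σ → Transitional X → v ⊩ demand X u σ → w ⊩ demand X v σ → w ⊩ demand X u σ
  demand-trans {u = u} {v} σ S4 d e = when-intro u σ (when-elim v σ e ∘ when-elim u σ d)
  demand-trans {u = u} {v} σ S5 d e = ∧-intro
    (when-intro u σ (when-elim v σ (∧-elim₁ e) ∘ when-elim u σ (∧-elim₁ d)))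
    (when-intro u (~ σ) (when-elim v (~ σ) (∧-elim₂ e) ∘ when-elim u (~ σ) (∧-elim₂ d)))

  ExtendsT? : ∀ X → Dec (ExtendsT X)
  ExtendsT? K  = no λ ()
  ExtendsT? D  = no λ ()
  ExtendsT? T  = yes tt
  ExtendsT? B  = yes tt
  ExtendsT? S4 = yes tt
  ExtendsT? S5 = yes tt

  D? : ∀ X → Dec (X ≡ D)
  D? K  = no λ ()
  D? D  = yes refl
  D? T  = no λ ()
  D? B  = no λ ()
  D? S4 = no λ ()
  D? S5 = no λ ()

  head-∈ : ∀ I → head I ∈ᴵ I
  head-∈ (_ ∷ _) = here refl

  Trig-mentions : ∀ {i} σ → Trig (i ∷ []) σ → i ∈ mentions σ
  Trig-mentions (□ _ _)     (here refl) = here refl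
  -- `I` is nonempty and contained in the singleton, so its head is `i`.
  Trig-mentions ([∩ I ] _)  t with t _ (head-∈ I)
  ... | here refl = head-∈ I
  Trig-mentions ([∪⁺ I ] _) t with _ , m , here refl ← find t = m

  -- Characteristic formulas and access between assignments.

  module Elimination (X : Sys) (φ₀ : Form) where

    private
      ⊢_ : Form → Set
      ⊢_ = ⊢[ X ]_

    Σ₀ : List Form
    Σ₀ = primes φ₀

    -- `char v` settles the value of such a formula, so its truth at `v` becomes derivability from
    -- `char v`.
    record Determined (ψ : Form) : Set where
      constructor det
      field same-value : ∀ {v w} → Agree Σ₀ v w → evalB v ψ ≡ evalB w ψ
    open Determined

    transport : ∀ {ψ v w} → Determined ψ → Agree Σ₀ v w → v ⊩ ψ → w ⊩ ψ
    transport d a ⟨ p ⟩ = ⟨ trans (sym (same-value d a)) p ⟩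

    transport⁻ : ∀ {ψ v w} → Determined ψ → Agree Σ₀ v w → w ⊩ ψ → v ⊩ ψ
    transport⁻ d a ⟨ p ⟩ = ⟨ trans (same-value d a) p ⟩

    det-∈ : ∀ {σ} → σ ∈ Σ₀ → Determined σ
    det-∈ m = det λ a → a m

    det-~ : ∀ {ψ} → Determined ψ → Determined (~ ψ)
    det-~ d = det λ a → cong not (same-value d a)

    det-⇒ : ∀ {ψ χ} → Determined ψ → Determined χ → Determined (ψ ⇒ χ)
    det-⇒ d e = det λ a → cong₂ (λ b c → not b ∨ c) (same-value d a) (same-value e a)

    det-∧ : ∀ {ψ χ} → Determined ψ → Determined χ → Determined (ψ ∧ᶠ χ)
    det-∧ d e = det-~ (det-⇒ d (det-~ e))

    det-⊤ : Determined ⊤ᶠ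
    det-⊤ = det λ {v} {w} _ → trans (eval {v} {⊤ᶠ} ⊩⊤) (sym (eval {w} {⊤ᶠ} ⊩⊤))

    det-primes : ∀ ψ → primes ψ ⊆ Σ₀ → Determined ψ
    det-primes (var _)     s = det-∈ (s (here refl))
    det-primes (~ ψ)       s = det-~ (det-primes ψ s)
    det-primes (ψ ⇒ χ)     s = det-⇒ (det-primes ψ (s ∘ ∈-++⁺ˡ)) (det-primes χ (s ∘ ∈-++⁺ʳ (primes ψ)))
    det-primes (□ _ _)     s = det-∈ (s (here refl))
    det-primes ([∩ _ ] _)  s = det-∈ (s (here refl))
    det-primes ([∪⁺ _ ] _) s = det-∈ (s (here refl))

    det-body : ∀ {σ} → σ ∈ Σ₀ → Determined (body σ)
    det-body {σ} m = go σ m (primes-trans φ₀ m)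
      where
      go : ∀ σ → σ ∈ Σ₀ → primes σ ⊆ Σ₀ → Determined (body σ)
      go (□ _ χ)     m s = det-primes χ (s ∘ there)
      go ([∩ _ ] χ)  m s = det-primes χ (s ∘ there)
      go ([∪⁺ _ ] χ) m s = det-∧ (det-primes χ (s ∘ there)) (det-∈ m)
      go (var _)     m s = det-∈ m
      go (~ _)       m s = det-∈ m
      go (_ ⇒ _)     m s = det-∈ m

    det-when : ∀ v χ {ψ} → Determined ψ → Determined (when v χ ψ)
    det-when v χ d with evalB v χ
    ... | true  = d
    ... | false = det-⊤

    det-demand : ∀ v {σ} → σ ∈ Σ₀ → Determined (demand X v σ)
    det-demand v {σ} m = go X
      where
      go : ∀ X → Determined (demand X v σ)
      go K  = det-when v σ (det-body m)
      go D  = det-when v σ (det-body m)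
      go T  = det-when v σ (det-body m)
      go B  = det-∧ (det-when v σ (det-body m)) (det-when v (~ body σ) (det-~ (det-∈ m)))
      go S4 = det-when v σ (det-∈ m)
      go S5 = det-∧ (det-when v σ (det-∈ m)) (det-when v (~ σ) (det-~ (det-∈ m)))

    literal : Val → Form → Form
    literal v σ = if evalB v σ then σ else ~ σ

    char : Val → Form
    char v = ⋀ᴸ (map (literal v) Σ₀)

    char-intro : ∀ {v w} → Agree Σ₀ v w → w ⊩ char v
    char-intro {v} {w} agree = ⋀ᴸ-intro (All.map⁺ (All.tabulate λ {σ} m → lit σ (agree m)))
      where
      lit : ∀ σ → evalB v σ ≡ evalB w σ → w ⊩ literal v σ
      lit σ e with evalB v σ
      ... | true  = ⟨ sym e ⟩
      ... | false = ⟨ cong not (sym e) ⟩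

    char-elim : ∀ {v w} → w ⊩ char v → Agree Σ₀ v w
    char-elim {v} {w} h {σ} m = lit σ (All.lookup (All.map⁻ (⋀ᴸ-elim _ h)) m)
      where
      lit : ∀ σ → w ⊩ literal v σ → evalB v σ ≡ evalB w σ
      lit σ p with evalB v σ
      ... | true  = sym (eval p)
      ... | false = sym (Bool.not-injective (eval p))

    det-char : ∀ {v} → Determined (char v)
    det-char {v} = go Σ₀ id
      where
      lit : ∀ σ → Determined σ → Determined (literal v σ)
      lit σ d with evalB v σ
      ... | true  = d
      ... | false = det-~ d
      go : ∀ Σ → Σ ⊆ Σ₀ → Determined (⋀ᴸ (map (literal v) Σ))
      go []      s = det-⊤
      go (σ ∷ Σ) s = det-∧ (lit σ (det-∈ (s (here refl)))) (go Σ (s ∘ there))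

    entail : ∀ {v ψ} → Determined ψ → v ⊩ ψ → ⊢ (char v ⇒ ψ)
    entail d p = tautology (⇒-intro λ c → transport d (char-elim c) p)

    Refuted : Val → Set
    Refuted v = ⊢ (~ char v)

    refute : ∀ {v ψ} → Determined ψ → ¬ v ⊩ ψ → ⊢ (char v ⇒ ψ) → Refuted v
    refute d ¬p q = consequence (q ∷ []) λ { (a ∷ []) →
      ~-intro λ c → ¬p (transport⁻ d (char-elim c) (⇒-elim a c)) }

    -- A finite counterpart of the canonical relation. Larger indices trigger more formulas, so
    -- access is antitone in `J`.
    Access : Index → Val → Val → Set
    Access J v w = All (λ σ → Trig J σ → w ⊩ demand X v σ) Σ₀

    Access? : ∀ J v w → Dec (Access J v w)
    Access? J v w = all? (λ σ → Trig? J σ →-dec (w ⊩? demand X v σ)) Σ₀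

    Access-anti : ∀ {I J v w} → I ⊆ᴵ J → Access J v w → Access I v w
    Access-anti s = All.map λ {σ} f → f ∘ Trig-mono s σ

    when-∩ : ∀ {J} v ψ {χ} → Determined ψ → ⊢ (ψ ⇒ [∩ J ] χ) → ⊢ (char v ⇒ [∩ J ] (when v ψ χ))
    when-∩ v ψ d p with evalB v ψ in eq
    ... | true  = entail d ⟨ eq ⟩ ⨾ p
    ... | false = weaken (nec∩ (tautology ⊩⊤))

    -- Ties access to provability: a demand whose condition fails at `v` is `⊤ᶠ`, and the others
    -- come from the unfolding lemmas.
    char-demand : ∀ {J v σ} → σ ∈ Σ₀ → Trig J σ → ⊢ (char v ⇒ [∩ J ] (demand X v σ))
    char-demand {J} {v} {σ} m t = go X refl
      where
      positive : ⊢ (char v ⇒ [∩ J ] (when v σ (body σ)))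
      positive = when-∩ v σ (det-∈ m) (unfold σ t)
      go : ∀ Y → X ≡ Y → ⊢ (char v ⇒ [∩ J ] (demand Y v σ))
      go K  _ = positive
      go D  _ = positive
      go T  _ = positive
      go B  refl = ∩-∧ positive (when-∩ v (~ body σ) (det-~ (det-body m)) (unfold-B σ B t))
      go S4 refl = when-∩ v σ (det-∈ m) (unfold-4 σ S4 t)
      go S5 refl = ∩-∧ (when-∩ v σ (det-∈ m) (unfold-4 σ S5 t))
                       (when-∩ v (~ σ) (det-~ (det-∈ m)) (unfold-5 σ t))

    -- Witnesses among the survivors.

    module _ (N : List Val) where

      Failure : Index → Val → Form → Set
      Failure J v ψ = ∃[ w ] w ∈ N × Access J v w × ¬ w ⊩ ψ

      Step : Index → Val → Val → Set
      Step J v w = Any (λ i → Access (i ∷ []) v w) (toList J)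

      -- At least one step is taken, to match the transitive closure that interprets `[∪⁺ J ]`.
      data Path (J : Index) (ψ : Form) (v : Val) : Set where
        stop : ∀ {w} → w ∈ N → Step J v w → ¬ w ⊩ ψ → Path J ψ v
        step : ∀ {w} → w ∈ N → Step J v w → Path J ψ w → Path J ψ v

      Witnessed : Val → Form → Set
      Witnessed v σ@(□ i χ)     = v ⊩ σ ⊎ Failure (i ∷ []) v χ
      Witnessed v σ@([∩ J ] χ)  = v ⊩ σ ⊎ Failure J v χ
      Witnessed v σ@([∪⁺ J ] χ) = v ⊩ σ ⊎ Path J χ v
      Witnessed v _             = ⊤

      record Saturated (v : Val) : Set where
        field
          witnessed : ∀ {σ} → σ ∈ Σ₀ → Witnessed v σ
          reflexive : ExtendsT X → ∀ {σ} → σ ∈ Σ₀ → v ⊩ σ → v ⊩ body σ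
          serial    : X ≡ D → ∀ i → ∃[ w ] w ∈ N × Access (i ∷ []) v w

    module _ (N : List Val) (cover : Cover (valuations Σ₀) Refuted N) where

      -- Every truth assignment agrees with a listed `v`, for which `char v` is either refutable or
      -- entails `ψ`. Hence `ψ` is a propositional consequence of the derivable `char v ⇒ ψ`.
      survivors-complete : ∀ {ψ} → Determined ψ → (∀ {v} → v ∈ N → v ⊩ ψ) → ⊢ ψ
      survivors-complete {ψ} d h = consequence {Γ = map (λ v → char v ⇒ ψ) (valuations Σ₀)}
        (All.map⁺ (All.tabulate (each ∘ cover)))
        λ {w} hyps → let v , m , agree = valuations-complete (primes-Prime φ₀) w in
          ⇒-elim (All.lookup (All.map⁻ hyps) m) (char-intro agree)
        where
        each : ∀ {v} → Refuted v ⊎ v ∈ N → ⊢ (char v ⇒ ψ)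
        each (inj₁ r) = consequence (r ∷ []) λ { (a ∷ []) → ⇒-intro λ c → contradiction c (~-elim a) }
        each (inj₂ m) = entail d (h m)

      -- At survivors, the demands triggered by `J` amount to access and so imply `ψ`. This
      -- implication is derivable, is necessitated, and `char-demand` discharges its premises.
      char-∩ : ∀ {J v ψ} → Determined ψ → (∀ {w} → w ∈ N → Access J v w → w ⊩ ψ) → ⊢ (char v ⇒ [∩ J ] ψ)
      char-∩ {J} {v} {ψ} d h = ∩-⇛ demands (weaken (nec∩ (survivors-complete (det-⇛ _ id) sem)))
        (All.map⁺ (All.tabulate λ m → let m′ , t = ∈-filter⁻ (Trig? J) m in char-demand m′ t))
        where
        triggered = filter (Trig? J) Σ₀
        demands   = map (demand X v) triggered
        sem : ∀ {w} → w ∈ N → w ⊩ demands ⇛ ψ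
        sem m = ⇛-intro demands λ ps → h m
          (All.tabulate λ m′ t → All.lookup (All.map⁻ ps) (∈-filter⁺ (Trig? J) m′ t))
        det-⇛ : ∀ Γ → Γ ⊆ triggered → Determined (map (demand X v) Γ ⇛ ψ)
        det-⇛ []      s = d
        det-⇛ (σ ∷ Γ) s = det-⇒ (det-demand v (proj₁ (∈-filter⁻ (Trig? J) (s (here refl)))))
                                (det-⇛ Γ (s ∘ there))

      ∩-witness : ∀ J v {ψ} → Determined ψ →
                  Failure N J v ψ ⊎ ⊢ (char v ⇒ [∩ J ] ψ)
      ∩-witness J v {ψ} d = Sum.map₂ (char-∩ d) (∀-⊎ N judge)
        where
        judge : ∀ {w} → w ∈ N → Failure N J v ψ ⊎ (Access J v w → w ⊩ ψ)
        judge {w} m with Access? J v w | w ⊩? ψ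
        ... | _      | yes p = inj₂ λ _ → p
        ... | no ¬a  | no ¬p = inj₂ λ a → contradiction a ¬a
        ... | yes a  | no ¬p = inj₁ (w , m , a , ¬p)

      -- Valuations with no path to a failure of ψ form an invariant for the induction rule ∪2.
      ∪-witness : ∀ {J v ψ} → v ∈ N → Determined ψ → Path N J ψ v ⊎ ⊢ (char v ⇒ [∪⁺ J ] ψ)
      -- Elimination runs here inside `N`, with a path to a failure as the ground for removal.
      ∪-witness {J} {v} {ψ} m d with eliminate N (Path N J ψ) Good judge
        where
        Good : List Val → Val → Set
        Good C v = ∀ {w} → w ∈ N → Step N J v w → w ⊩ ψ × w ∈ C
        judge : ∀ C → Cover N (Path N J ψ) C → ∀ {v} → v ∈ C → Path N J ψ v ⊎ Good C v
        judge C cover {v} _ = ∀-⊎ N λ m → successor m (cover m)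
          where
          successor : ∀ {w} → w ∈ N → Path N J ψ w ⊎ w ∈ C → Path N J ψ v ⊎ (Step N J v w → w ⊩ ψ × w ∈ C)
          successor {w} m c with any? (λ i → Access? (i ∷ []) v w) (toList J) | w ⊩? ψ | c
          ... | no ¬s | _     | _       = inj₂ λ s → contradiction s ¬s
          ... | yes s | no ¬p | _       = inj₁ (stop m s ¬p)
          ... | yes s | yes p | inj₁ pa = inj₁ (step m s pa)
          ... | yes s | yes p | inj₂ mc = inj₂ λ _ → p , mc
      ... | C , coverC , good with coverC m
      ...   | inj₁ p  = inj₁ p
      ...   | inj₂ mC = inj₂ (tautology (⇒-intro (⋁ᴸ-intro (∈-map⁺ char mC))) ⨾ rule-∪2 (⊢⋀-intro _ _ inv))
        where
        θ : Form
        θ = ⋁ᴸ (map char C)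
        det-θ : ∀ C → Determined (⋁ᴸ (map char C))
        det-θ []      = det-~ det-⊤
        det-θ (c ∷ C) = det-⇒ (det-~ det-char) (det-θ C)
        -- Every step along `i` from a member of `C` satisfies `ψ` and stays in `C`, as the premise
        -- of ∪2 requires.
        inv : ∀ {i} → i ∈ᴵ J → ⊢ (θ ⇒ □ i (θ ∧ᶠ ψ))
        inv {i} mi = ⊢⋁-elim (All.map⁺ (All.tabulate λ mc → char-∩ (det-∧ (det-θ C) d)
          (λ mw a → let p , mc′ = good mc mw (lose mi a) in
             ∧-intro (⋁ᴸ-intro (∈-map⁺ char mc′) (char-intro λ _ → refl)) p) ⨾ ∩⇒□))

      witnessed? : ∀ {v σ} → v ∈ N → σ ∈ Σ₀ → Refuted v ⊎ Witnessed N v σ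
      witnessed? {v} {σ} mv mσ = go σ mσ (det-body mσ) (primes-trans φ₀ mσ)
        where
        conclude : ∀ {σ} {A : Set} → σ ∈ Σ₀ → A ⊎ ⊢ (char v ⇒ σ) → Refuted v ⊎ (v ⊩ σ ⊎ A)
        conclude {σ} m (inj₁ a) = inj₂ (inj₂ a)
        conclude {σ} m (inj₂ p) with v ⊩? σ
        ... | yes q = inj₂ (inj₁ q)
        ... | no ¬q = inj₁ (refute (det-∈ m) ¬q p)
        go : ∀ σ → σ ∈ Σ₀ → Determined (body σ) → primes σ ⊆ Σ₀ → Refuted v ⊎ Witnessed N v σ
        go (□ i χ)     m d s = conclude m (Sum.map₂ (_⨾ ∩⇒□) (∩-witness (i ∷ []) v d))
        go ([∩ J ] χ)  m d s = conclude m (∩-witness J v d)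
        go ([∪⁺ J ] χ) m d s = conclude m (∪-witness mv (det-primes χ (s ∘ there)))
        go (var _)     m d s = inj₂ tt
        go (~ _)       m d s = inj₂ tt
        go (_ ⇒ _)     m d s = inj₂ tt

      reflexive? : ∀ {v σ} → σ ∈ Σ₀ → Refuted v ⊎ (ExtendsT X → v ⊩ σ → v ⊩ body σ)
      reflexive? {v} {σ} m with ExtendsT? X | v ⊩? σ | v ⊩? body σ
      ... | no ¬e | _     | _     = inj₂ λ e → contradiction e ¬e
      ... | yes e | no ¬p | _     = inj₂ λ _ p → contradiction p ¬p
      ... | yes e | yes p | yes q = inj₂ λ _ _ → q
      ... | yes e | yes p | no ¬q = inj₁ (refute (det-body m) ¬q (entail (det-∈ m) p ⨾ unfold-T σ e))

      serial? : ∀ {v} → v ∈ N → Refuted v ⊎ (X ≡ D → ∀ i → ∃[ w ] w ∈ N × Access (i ∷ []) v w)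
      serial? {v} mv with D? X
      ... | no ¬D    = inj₂ λ e → contradiction e ¬D
      ... | yes refl = Sum.map₂ extend (∀-⊎ agents λ {i} _ → mentioned i)
        where
        agents : List 𝕀
        agents = concatMap mentions Σ₀
        mentioned : ∀ i → Refuted v ⊎ (∃[ w ] w ∈ N × Access (i ∷ []) v w)
        -- A failure of `~ ⊤ᶠ` is just any successor; without one, `char v` proves `□ i (~ ⊤ᶠ)`,
        -- against D.
        mentioned i with ∩-witness (i ∷ []) v (det-~ det-⊤)
        ... | inj₁ (w , m , a , _) = inj₂ (w , m , a)
        ... | inj₂ p = inj₁ (consequence
          (p ⨾ ∩⇒□ ⨾ extra D-ax ∷ nec (tautology (~-intro λ q → ~-elim q ⊩⊤)) ∷ [])
          λ { (a ∷ b ∷ []) → ~-intro λ c → ~-elim (⇒-elim a c) b })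
        extend : (∀ {i} → i ∈ agents → ∃[ w ] w ∈ N × Access (i ∷ []) v w) →
                 D ≡ D → ∀ i → ∃[ w ] w ∈ N × Access (i ∷ []) v w
        extend h _ i with any? (i ≟ᴵ_) agents
        ... | yes m = h m
        -- A type that occurs in no formula of `Σ₀` triggers nothing, so `v` can be its own
        -- successor.
        ... | no ¬m = v , mv , All.tabulate λ {σ} m t →
          contradiction (∈-concatMap⁺ mentions (lose m (Trig-mentions σ t))) ¬m

      saturated? : ∀ {v} → v ∈ N → Refuted v ⊎ Saturated N v
      saturated? {v} m with ∀-⊎ Σ₀ (witnessed? m) | ∀-⊎ Σ₀ (reflexive? {v}) | serial? m
      ... | inj₁ r | _      | _      = inj₁ r
      ... | inj₂ _ | inj₁ r | _      = inj₁ r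
      ... | inj₂ _ | inj₂ _ | inj₁ r = inj₁ r
      ... | inj₂ w | inj₂ r | inj₂ s = inj₂ record { witnessed = w ; reflexive = λ e m → r m e ; serial = s }

    -- The tree countermodel.

    -- In a tree, two worlds are joined by only one path, so being linked for each i ∈ I separately
    -- forces every label on that path to contain I; this is what makes [∩ I ] sound.
    module Countermodel (N : List Val) (saturated : ∀ {v} → v ∈ N → Saturated N v) where

      open Saturated

      -- A world is the history leading to it, which makes parents unique. Access is required of an
      -- `Edge` only, not of `ext`.
      data World : Set where
        root : ∀ {v} → v ∈ N → World
        ext  : World → Index → ∀ {v} → v ∈ N → World

      at : World → Val
      at (root {v} _)    = v
      at (ext _ _ {v} _) = v

      at-∈ : ∀ s → at s ∈ N
      at-∈ (root m)    = m
      at-∈ (ext _ _ m) = m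

      depth : World → ℕ
      depth (root _)    = 0
      depth (ext s _ _) = suc (depth s)

      data Edge (i : 𝕀) (s : World) : World → Set where
        edge : ∀ {J v} {m : v ∈ N} → i ∈ᴵ J → Access J (at s) v → Edge i s (ext s J m)

      edge-depth : ∀ {i s t} → Edge i s t → depth s < depth t
      edge-depth (edge _ _) = ℕ.n<1+n _

      same-way : ∀ {i j s t} → Edge i s t → Edge j s t ⊎ Edge j t s → Edge j s t
      same-way e (inj₁ e′) = e′
      same-way e (inj₂ e′) = contradiction (edge-depth e′) (ℕ.<-asym (edge-depth e))

      data Up (i : 𝕀) (s : World) : World → Set where
        done : Up i s s
        _▹_  : ∀ {t u} → Up i s t → Edge i t u → Up i s u

      Up-trans : ∀ {i s t u} → Up i s t → Up i t u → Up i s u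
      Up-trans p done    = p
      Up-trans p (q ▹ e) = Up-trans p q ▹ e

      Up-ext : ∀ {i s u J v} {m : v ∈ N} → Up i s (ext u J m) → s ≡ ext u J m ⊎ (Up i s u × Edge i u (ext u J m))
      Up-ext done                = inj₁ refl
      Up-ext (p ▹ e@(edge _ _))  = inj₂ (p , e)

      -- The highest ancestor reached through edges for `i`: a canonical representative of the
      -- component, so equality of tops is the equivalence closure of these edges.
      top : 𝕀 → World → World
      top i t@(root _) = t
      top i t@(ext s J {v} _) with (i ∈ᴵ? J) ×-dec Access? J (at s) v
      ... | yes _ = top i s
      ... | no _  = t

      top-ext : ∀ i s J {v} (m : v ∈ N) →
                top i (ext s J m) ≡ ext s J m ⊎ (Edge i s (ext s J m) × top i (ext s J m) ≡ top i s)
      top-ext i s J {v} m with (i ∈ᴵ? J) ×-dec Access? J (at s) v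
      ... | yes (mi , a) = inj₂ (edge mi a , refl)
      ... | no _         = inj₁ refl

      top-edge : ∀ {i s t} → Edge i s t → top i s ≡ top i t
      top-edge {i} {s} (edge {J} {v} mi a) with (i ∈ᴵ? J) ×-dec Access? J (at s) v
      ... | yes _ = refl
      ... | no ¬p = contradiction (mi , a) ¬p

      top-depth : ∀ i t → top i t ≡ t ⊎ depth (top i t) < depth t
      top-depth i (root _) = inj₁ refl
      top-depth i (ext s J m) with top-ext i s J m
      ... | inj₁ e = inj₁ e
      ... | inj₂ (_ , e) rewrite e with top-depth i s
      ...   | inj₁ e′ rewrite e′ = inj₂ (ℕ.n<1+n _)
      ...   | inj₂ lt            = inj₂ (ℕ.m<n⇒m<1+n lt)

      -- If `t` were not its own top, `s` would lie strictly above it, against the bound on depths.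
      top-fixed : ∀ {i s t} → top i s ≡ s → top i s ≡ top i t → depth t ≤ depth s → s ≡ t
      top-fixed {i} {s} {t} fixed e le with top-depth i t
      ... | inj₁ e′ = trans (sym fixed) (trans e e′)
      ... | inj₂ lt = contradiction (ℕ.<-≤-trans lt le)
                        (ℕ.<-irrefl (cong depth (trans (sym e) fixed)))

      access-refl : ∀ {J} s → ExtendsT X → Access J (at s) (at s)
      access-refl s e = All.tabulate λ {σ} m _ → demand-refl X σ e (reflexive (saturated (at-∈ s)) e m)

      access-sym : ∀ {J v w} → Symmetrical X → Access J v w → Access J w v
      access-sym y = All.map λ {σ} f → demand-sym σ y ∘ f

      access-trans : ∀ {J u v w} → Transitional X → Access J u v → Access J v w → Access J u w
      access-trans y a b = All.zipWith (λ {σ} (f , g) t → demand-trans σ y (f t) (g t)) (a , b)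

      access-body : ∀ {J σ v} s → σ ∈ Σ₀ → Trig J σ → Access J v (at s) → v ⊩ σ → at s ⊩ body σ
      access-body {σ = σ} s m t a = demand-body X σ (λ e → reflexive (saturated (at-∈ s)) e m) (All.lookup a m t)

      -- The world `t` records a single label, which must contain all of `I`.
      edges-access : ∀ I {s t} → (∀ {i} → i ∈ᴵ I → Edge i s t) → Access I (at s) (at t)
      edges-access I {s} h with h (head-∈ I)
      ... | edge {J} {m = m} _ a = Access-anti (λ i mi → label (h mi)) a
        where
        label : ∀ {i} → Edge i s (ext s J m) → i ∈ᴵ J
        label (edge mi _) = mi

      -- Unless some chain is empty, all chains end in the edge from the parent of `t`; induction
      -- handles the rest.
      ups-access : ExtendsT X → Transitional X → ∀ I {s} t →
                   (∀ {i} → i ∈ᴵ I → Up i s t) → Access I (at s) (at t)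
      ups-access e y I (root m) h with h (head-∈ I)
      ... | done = access-refl (root m) e
      ups-access e y I (ext u J m) h with ∀-⊎ (toList I) (λ mi → Up-ext (h mi))
      ... | inj₁ refl = access-refl (ext u J m) e
      ... | inj₂ g    = access-trans y (ups-access e y I u (λ m → proj₁ (g m))) (edges-access I (λ m → proj₂ (g m)))

      -- Of two distinct worlds with equal tops, the deeper hangs by a label containing I: otherwise it would be its own
      -- top for some i ∈ I, and the shallower world could not share that top.
      descend : ∀ I s t → depth t ≤ depth s → (∀ {i} → i ∈ᴵ I → top i s ≡ top i t) →
                s ≡ t ⊎ (∃[ u ] depth u < depth s × Access I (at u) (at s) × (∀ {i} → i ∈ᴵ I → top i u ≡ top i t))
      descend I (root m) t le h = inj₁ (top-fixed refl (h (head-∈ I)) le)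
      descend I s@(ext u J m) t le h = Sum.map₂ (λ g → u , ℕ.n<1+n _ , edges-access I (λ m → proj₁ (g m)) , λ m → proj₂ (g m))
        (∀-⊎ (toList I) λ {i} mi → Sum.map (λ e → top-fixed e (h mi) le) (map₂ (λ e → trans (sym e) (h mi))) (top-ext i u J m))

      -- `n` bounds the sum of depths. The deeper world is replaced by its parent, and symmetry and
      -- transitivity of access join the pieces.
      tops-access : X ≡ S5 → ∀ I n s t → depth s ℕ.+ depth t < n →
                    (∀ {i} → i ∈ᴵ I → top i s ≡ top i t) → Access I (at s) (at t)
      tops-access refl I (suc n) s t (ℕ.s≤s lt) h with ℕ.≤-total (depth t) (depth s)
      ... | inj₁ le with descend I s t le h
      ...   | inj₁ refl = access-refl s tt
      ...   | inj₂ (u , u<s , a , g) = access-trans S5 (access-sym S5 a)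
        (tops-access refl I n u t (ℕ.<-≤-trans (ℕ.+-monoˡ-< (depth t) u<s) lt) g)
      tops-access refl I (suc n) s t (ℕ.s≤s lt) h | inj₂ le with descend I t s le (λ m → sym (h m))
      ...   | inj₁ refl = access-refl s tt
      ...   | inj₂ (u , u<t , a , g) = access-trans S5
        (tops-access refl I n s u (ℕ.<-≤-trans (ℕ.+-monoʳ-< (depth s) u<t) lt) (λ m → sym (g m))) a

      -- The model and its truth lemma.

      Link : Sys → 𝕀 → Rel World 0ℓ
      Link K  i     = Edge i
      Link D  i     = Edge i
      Link T  i s t = s ≡ t ⊎ Edge i s t
      Link B  i s t = s ≡ t ⊎ (Edge i s t ⊎ Edge i t s)
      Link S4 i     = Up i
      Link S5 i     = _≡_ on top i

      edge-link : ∀ Y {i s t} → Edge i s t → Link Y i s t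
      edge-link K  e = e
      edge-link D  e = e
      edge-link T  e = inj₂ e
      edge-link B  e = inj₂ (inj₁ e)
      edge-link S4 e = done ▹ e
      edge-link S5 e = top-edge e

      -- Here the tree shape pays off: separate links for the types in `I` combine into access for
      -- `I` as a whole.
      links-access : ∀ Y → X ≡ Y → ∀ I s t → (∀ {i} → i ∈ᴵ I → Link Y i s t) → Access I (at s) (at t)
      links-access K  _ I s t h = edges-access I h
      links-access D  _ I s t h = edges-access I h
      links-access T refl I s t h with ∀-⊎ (toList I) h
      ... | inj₁ refl = access-refl s tt
      ... | inj₂ g    = edges-access I g
      links-access B refl I s t h with ∀-⊎ (toList I) h
      ... | inj₁ refl = access-refl s tt
      ... | inj₂ g with g (head-∈ I)
      ...   | inj₁ e = edges-access I λ m → same-way e (g m)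
      ...   | inj₂ e = access-sym B (edges-access I λ m → same-way e (Sum.swap (g m)))
      links-access S4 refl I s t h = ups-access tt S4 I t h
      links-access S5 refl I s t h = tops-access refl I _ s t (ℕ.n<1+n _) h

      model : Sys → World → Model
      model Y s = record { S = World ; nonempty = s ; R = Link Y ; V = λ p t → at t ⊩ var p }

      in-class : ∀ Y → X ≡ Y → ∀ s → InClass Y (model Y s)
      in-class K  _    _ = tt
      in-class D  refl _ i s with w , m , a ← serial (saturated (at-∈ s)) refl i =
        ext s (i ∷ []) m , edge (here refl) a
      in-class T  _    _ i = inj₁ refl
      in-class B  _    _ i = inj₁ refl , Sum.map sym Sum.swap
      in-class S4 _    _ i = done , Up-trans
      in-class S5 _    _ i = On.isEquivalence (top i) isEquivalence

      module _ (s₀ : World) where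

        _⊨ᴹ_ : World → Form → Set
        _⊨ᴹ_ = _⊨_ (model X s₀)

        -- Each step becomes a new child whose label is a single type.
        path-lift : ∀ {J χ} s → Path N J χ (at s) → ∃[ t ] R∪⁺ (model X s₀) J s t × ¬ at t ⊩ χ
        path-lift s (stop m st ¬p) with i , mi , a ← find st =
          ext s (i ∷ []) m , [ i , mi , edge-link X (edge (here refl) a) ] , ¬p
        path-lift s (step m st p) with i , mi , a ← find st =
          map₂ (λ (r , ¬p) → (i , mi , edge-link X (edge (here refl) a)) ∷ r , ¬p) (path-lift (ext s (i ∷ []) m) p)

        link-access : ∀ {i s t} → Link X i s t → Access (i ∷ []) (at s) (at t)
        link-access {i} r = links-access X refl (i ∷ []) _ _ λ { (here refl) → r }

        -- The body of `[∪⁺ J ] χ` contains the formula again, so it survives each link of the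
        -- chain.
        ∪-body : ∀ {J χ s t} → [∪⁺ J ] χ ∈ Σ₀ → R∪⁺ (model X s₀) J s t → at s ⊩ [∪⁺ J ] χ → at t ⊩ χ
        ∪-body {t = t} m [ _ , mi , r ] p = ∧-elim₁ (access-body t m (lose mi (here refl)) (link-access r) p)
        ∪-body m (_∷_ {y = u} (_ , mi , r) c) p =
          ∪-body m c (∧-elim₂ (access-body u m (lose mi (here refl)) (link-access r) p))

        -- Both directions go together, as negation and implication exchange them. For modalities,
        -- `witnessed` gives one direction and access the other.
        truth : ∀ ψ → primes ψ ⊆ Σ₀ → ∀ s → (s ⊨ᴹ ψ → at s ⊩ ψ) × (at s ⊩ ψ → s ⊨ᴹ ψ)
        truth (var _) sub s = id , id
        truth (~ ψ) sub s with f , g ← truth ψ sub s = (λ h → ~-intro (h ∘ g)) , (λ h → ~-elim h ∘ f)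
        truth (ψ ⇒ χ) sub s
          with f , g ← truth ψ (sub ∘ ∈-++⁺ˡ) s | f′ , g′ ← truth χ (sub ∘ ∈-++⁺ʳ (primes ψ)) s =
          (λ h → ⇒-intro (f′ ∘ h ∘ g)) , (λ h → g′ ∘ ⇒-elim h ∘ f)
        truth (□ i χ) sub s = forth , back
          where
          forth : s ⊨ᴹ □ i χ → at s ⊩ □ i χ
          forth h with witnessed (saturated (at-∈ s)) (sub (here refl))
          ... | inj₁ p = p
          ... | inj₂ (w , m , a , ¬p) = contradiction
            (proj₁ (truth χ (sub ∘ there) (ext s (i ∷ []) m)) (h _ (edge-link X (edge (here refl) a)))) ¬p
          back : at s ⊩ □ i χ → s ⊨ᴹ □ i χ
          back p t r = proj₂ (truth χ (sub ∘ there) t) (access-body t (sub (here refl)) (here refl) (link-access r) p)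
        truth ([∩ J ] χ) sub s = forth , back
          where
          forth : s ⊨ᴹ [∩ J ] χ → at s ⊩ [∩ J ] χ
          forth h with witnessed (saturated (at-∈ s)) (sub (here refl))
          ... | inj₁ p = p
          ... | inj₂ (w , m , a , ¬p) = contradiction
            (proj₁ (truth χ (sub ∘ there) (ext s J m)) (h _ λ i mi → edge-link X (edge mi a))) ¬p
          back : at s ⊩ [∩ J ] χ → s ⊨ᴹ [∩ J ] χ
          back p t r = proj₂ (truth χ (sub ∘ there) t)
            (access-body t (sub (here refl)) (λ _ → id) (links-access X refl J s t (r _)) p)
        truth ([∪⁺ J ] χ) sub s = forth , back
          where
          forth : s ⊨ᴹ [∪⁺ J ] χ → at s ⊩ [∪⁺ J ] χ
          forth h with witnessed (saturated (at-∈ s)) (sub (here refl))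
          ... | inj₁ p = p
          ... | inj₂ π with t , r , ¬p ← path-lift s π =
            contradiction (proj₁ (truth χ (sub ∘ there) t) (h t r)) ¬p
          back : at s ⊩ [∪⁺ J ] χ → s ⊨ᴹ [∪⁺ J ] χ
          back p t r = proj₂ (truth χ (sub ∘ there) t) (∪-body (sub (here refl)) r p)

    completeness : Valid X φ₀ → ⊢ φ₀
    completeness valid with eliminate (valuations Σ₀) Refuted Saturated saturated?
    ... | N , cover , saturated = survivors-complete N cover (det-primes φ₀ id) true-at
      where
      open Countermodel N saturated
      true-at : ∀ {v} → v ∈ N → v ⊩ φ₀
      true-at m = proj₁ (truth (root m) φ₀ id (root m)) (valid (model X (root m)) (in-class X refl (root m)) (root m))

theorem2 : (𝕀 : Set) → AtMostCountable 𝕀 → (X : Sys) → (φ : Lang.Form 𝕀)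
    → Lang.Valid 𝕀 X φ → Lang.⊢[_]_ 𝕀 X φ
theorem2 𝕀 countable X φ = Completeness.Elimination.completeness 𝕀 countable X φ
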